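{- The subspace $M$ of strongly maximal elements of a continuous dcpo $D$ with the relative Scott topology is regular, i.e. for every $x\in M$, every (relative) Scott neighbourhood of $x$ in $M$ contains a (relatively) Scott closed neighbourhood of $x$ in $M$.
   Context: Everything is constructive: neither excluded middle nor choice is assumed. A subset $S$ of a poset is directed if it is inhabited and any two elements of $S$ have an upper bound in $S$. A dcpo is a poset $(D,\sqsubseteq)$ in which every directed subset $S$ has a supremum $\bigsqcup S$. Write $x\ll y$ ($x$ is way below $y$) if for every directed $S$ with $y\sqsubseteq\bigsqcup S$ there is $s\in S$ with $x\sqsubseteq s$. $D$ is continuous if for every $x$ the set $\{y\in D\mid y\ll x\}$ is directed with supremum $x$. A subset $U\subseteq D$ is Scott open if it is an upper set and whenever $\bigsqcup S\in U$ with $S$ directed, some $s\in S$ is in $U$. A subset $C\subseteq D$ is Scott closed if it is a lower set closed under directed suprema. Two points of $D$ are Hausdorff separated if they have disjoint Scott open neighbourhoods. An element $x$ of a continuous dcpo $D$ is strongly maximal if for every $u,v\in D$ with $u\ll v$, we have $u\ll x$, or $v$ and $x$ are Hausdorff separated. Relatively Scott open (closed) subsets of $M$ are the intersections with $M$ of Scott open (closed) subsets of $D$; a relative Scott neighbourhood of $x$ in $M$ is a subset of $M$ containing a relatively Scott open set that contains $x$. -}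

module Defs where

open import Data.Product using (Σ; ∃-syntax; _×_; proj₁)
open import Data.Sum using (_⊎_)
open import Function using (flip)
open import Level using (Level; suc; _⊔_)
open import Relation.Binary.Bundles using (Poset)
open import Relation.Binary.Definitions using (_Respects_)
open import Relation.Unary using (Pred; _∈_; _⊆_; _≐_; _⊢_; _⊥_; Satisfiable)

-- A single universe Set ℓ plays the role of the sets: the posets live in it,
-- and the powerset of D consists of the predicates Pred D ℓ.  Relations that
-- quantify over this powerset (such as _≪_ below) live in Set (suc ℓ).

module _ {ℓ : Level} (P : Poset ℓ ℓ ℓ) where
  open Poset P renaming (_≤_ to _⊑_)

  IsDirected : Pred Carrier ℓ → Set ℓ
  IsDirected S =
    Satisfiable S ×
    (∀ {x y} → x ∈ S → y ∈ S → ∃[ z ] z ∈ S × x ⊑ z × y ⊑ z)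

  IsSupremum : Pred Carrier ℓ → Carrier → Set ℓ
  IsSupremum S x =
    (∀ {y} → y ∈ S → y ⊑ x) ×
    (∀ z → (∀ {y} → y ∈ S → y ⊑ z) → x ⊑ z)

record DCPO (ℓ : Level) : Set (suc ℓ) where
  field
    poset : Poset ℓ ℓ ℓ

  open Poset poset public renaming (_≤_ to _⊑_)

  field
    ⨆            : (S : Pred Carrier ℓ) → IsDirected poset S → Carrier
    ⨆-isSupremum : ∀ S (dir : IsDirected poset S) → IsSupremum poset S (⨆ S dir)

  infix 4 _≪_

  _≪_ : Carrier → Carrier → Set (suc ℓ)
  x ≪ y = ∀ (S : Pred Carrier ℓ) (dir : IsDirected poset S) →
          y ⊑ ⨆ S dir → ∃[ s ] s ∈ S × x ⊑ s

  -- { y ∣ y ≪ x } has to be an element of the powerset for its supremum to be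
  -- formed.  As _≪_ lives in Set (suc ℓ), this is expressed by asking for a
  -- subset S in Set ℓ with exactly these elements; with impredicative
  -- powersets such an S always exists.
  IsContinuous : Set (suc ℓ)
  IsContinuous = ∀ x →
    ∃[ S ] S ≐ (_≪ x) × IsDirected poset S × IsSupremum poset S x

  IsScottOpen : Pred Carrier ℓ → Set (suc ℓ)
  IsScottOpen U =
    U Respects _⊑_ ×
    (∀ S (dir : IsDirected poset S) → ⨆ S dir ∈ U → ∃[ s ] s ∈ S × s ∈ U)

  IsScottClosed : Pred Carrier ℓ → Set (suc ℓ)
  IsScottClosed C =
    C Respects (flip _⊑_) ×
    (∀ S (dir : IsDirected poset S) → S ⊆ C → ⨆ S dir ∈ C)

  HausdorffSeparated : Carrier → Carrier → Set (suc ℓ)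
  HausdorffSeparated x y =
    ∃[ U ] ∃[ V ] IsScottOpen U × IsScottOpen V × x ∈ U × y ∈ V × U ⊥ V

  IsStronglyMaximal : Carrier → Set (suc ℓ)
  IsStronglyMaximal x = ∀ u v → u ≪ v → u ≪ x ⊎ HausdorffSeparated v x

  StronglyMaximal : Set (suc ℓ)
  StronglyMaximal = Σ Carrier IsStronglyMaximal

  -- Subsets of the subspace M of strongly maximal elements are predicates on
  -- StronglyMaximal, and proj₁ ⊢ U is the intersection of U with M.

  IsRelativelyOpen : ∀ {a} → Pred StronglyMaximal a → Set (suc ℓ ⊔ a)
  IsRelativelyOpen A = ∃[ U ] IsScottOpen U × A ≐ (proj₁ ⊢ U)

  IsRelativelyClosed : ∀ {a} → Pred StronglyMaximal a → Set (suc ℓ ⊔ a)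
  IsRelativelyClosed A = ∃[ C ] IsScottClosed C × A ≐ (proj₁ ⊢ C)

  IsNeighbourhood : ∀ {a} → StronglyMaximal → Pred StronglyMaximal a → Set (suc ℓ ⊔ a)
  IsNeighbourhood x N =
    Σ (Pred StronglyMaximal ℓ) λ A → IsRelativelyOpen A × x ∈ A × A ⊆ N

{-# OPTIONS --safe #-}

-- Choose u ≪ v ≪ x with u in the given open set U.  The points that cannot be
-- separated from v form a Scott closed set containing every y ≫ v, and strong
-- maximality applied to u ≪ v puts each strongly maximal one of them above u,
-- hence in U.
module Submission where

open import Defs
open import Data.Empty using (⊥-elim)
open import Data.Product using (Σ; ∃-syntax; _×_; _,_; proj₁; proj₂)
open import Data.Sum using (inj₁; inj₂)
open import Function using (id)
open import Level using (Level)
open import Relation.Nullary using (¬_)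
open import Relation.Unary using (Pred; _∈_; _⊆_; _⊢_)

module _ {ℓ : Level} (D : DCPO ℓ) where
  open DCPO D

  ⊑-≪-trans : ∀ {x y z} → x ⊑ y → y ≪ z → x ≪ z
  ⊑-≪-trans x⊑y y≪z S dir z⊑⨆S with y≪z S dir z⊑⨆S
  ... | s , s∈S , y⊑s = s , s∈S , trans x⊑y y⊑s

  ≪-⊑-trans : ∀ {x y z} → x ≪ y → y ⊑ z → x ≪ z
  ≪-⊑-trans x≪y y⊑z S dir z⊑⨆S = x≪y S dir (trans y⊑z z⊑⨆S)

  module _ (cont : IsContinuous) where

    -- The sets supplied by continuity give a copy of _≪_ in Set ℓ, so that
    -- subsets defined from the way-below relation stay in the powerset.
    ↡ : Carrier → Pred Carrier ℓ
    ↡ x = proj₁ (cont x)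

    ↡⇒≪ : ∀ {x y} → y ∈ ↡ x → y ≪ x
    ↡⇒≪ {x} = proj₁ (proj₁ (proj₂ (cont x)))

    ≪⇒↡ : ∀ {x y} → y ≪ x → y ∈ ↡ x
    ≪⇒↡ {x} = proj₂ (proj₁ (proj₂ (cont x)))

    ↡-directed : ∀ x → IsDirected poset (↡ x)
    ↡-directed x = proj₁ (proj₂ (proj₂ (cont x)))

    ↡-isSupremum : ∀ x → IsSupremum poset (↡ x) x
    ↡-isSupremum x = proj₂ (proj₂ (proj₂ (cont x)))

    ↡-⊑ : ∀ {x y} → y ∈ ↡ x → y ⊑ x
    ↡-⊑ {x} = proj₁ (↡-isSupremum x)

    ↡-mono : ∀ {x y} → x ⊑ y → ↡ x ⊆ ↡ y
    ↡-mono x⊑y b∈↡x = ≪⇒↡ (≪-⊑-trans (↡⇒≪ b∈↡x) x⊑y)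

    ↡² : Carrier → Pred Carrier ℓ
    ↡² x a = ∃[ c ] c ∈ ↡ x × a ∈ ↡ c

    ↡²-directed : ∀ x → IsDirected poset (↡² x)
    ↡²-directed x = inhabited , bounded
      where
      inhabited : ∃[ a ] a ∈ ↡² x
      inhabited with proj₁ (↡-directed x)
      ... | c , c∈↡x with proj₁ (↡-directed c)
      ... | a , a∈↡c = a , c , c∈↡x , a∈↡c

      bounded : ∀ {a b} → a ∈ ↡² x → b ∈ ↡² x → ∃[ z ] z ∈ ↡² x × a ⊑ z × b ⊑ z
      bounded (c , c∈↡x , a∈↡c) (d , d∈↡x , b∈↡d)
        with proj₂ (↡-directed x) c∈↡x d∈↡x
      ... | e , e∈↡x , c⊑e , d⊑e
        -- `a` and `b` approximate different points `c` and `d`; both move into `↡ e`, where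
        -- directedness applies.
        with proj₂ (↡-directed e) (↡-mono c⊑e a∈↡c) (↡-mono d⊑e b∈↡d)
      ... | z , z∈↡e , a⊑z , b⊑z = z , (e , e∈↡x , z∈↡e) , a⊑z , b⊑z

    ⊑-⨆↡² : ∀ x → x ⊑ ⨆ (↡² x) (↡²-directed x)
    ⊑-⨆↡² x = proj₂ (↡-isSupremum x) _ λ {c} c∈↡x →
      proj₂ (↡-isSupremum c) _ λ a∈↡c →
        proj₁ (⨆-isSupremum (↡² x) (↡²-directed x)) (c , c∈↡x , a∈↡c)

    -- Testing `u ≪ x` against the directed set `↡² x` puts `u` below some `a ≪ c ≪ x`, and `c`
    -- interpolates.
    ≪-interpolate : ∀ {u x} → u ≪ x → ∃[ v ] u ≪ v × v ≪ x
    ≪-interpolate {x = x} u≪x with u≪x (↡² x) (↡²-directed x) (⊑-⨆↡² x)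
    ... | a , (c , c∈↡x , a∈↡c) , u⊑a = c , ⊑-≪-trans u⊑a (↡⇒≪ a∈↡c) , ↡⇒≪ c∈↡x

    -- Way-below alone only gives `u ⊑ s`. Applying it to an interpolant `v` gives `u ≪ v ⊑ s`.
    ≪-⨆ : ∀ {u} S (dir : IsDirected poset S) → u ≪ ⨆ S dir → ∃[ s ] s ∈ S × u ≪ s
    ≪-⨆ S dir u≪⨆S with ≪-interpolate u≪⨆S
    ... | v , u≪v , v≪⨆S with v≪⨆S S dir refl
    ... | s , s∈S , v⊑s = s , s∈S , ≪-⊑-trans u≪v v⊑s

    ↟ : Carrier → Pred Carrier ℓ
    ↟ v y = v ∈ ↡ y

    ↟-isScottOpen : ∀ v → IsScottOpen (↟ v)
    ↟-isScottOpen v = (λ x⊑y → ↡-mono x⊑y) , inaccessible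
      where
      inaccessible : ∀ S (dir : IsDirected poset S) → ⨆ S dir ∈ ↟ v → ∃[ s ] s ∈ S × s ∈ ↟ v
      inaccessible S dir v∈↡⨆S with ≪-⨆ S dir (↡⇒≪ v∈↡⨆S)
      ... | s , s∈S , v≪s = s , s∈S , ≪⇒↡ v≪s

    -- `x` lies below the chosen supremum of `↡ x`, which is therefore in `U`; inaccessibility does
    -- the rest.
    open⇒approximant : ∀ {U x} → IsScottOpen U → x ∈ U → ∃[ u ] u ∈ ↡ x × u ∈ U
    open⇒approximant {x = x} (upper , inaccessible) x∈U =
      inaccessible (↡ x) dir (upper x⊑⨆ x∈U)
      where
      dir = ↡-directed x

      x⊑⨆ : x ⊑ ⨆ (↡ x) dir
      x⊑⨆ = proj₂ (↡-isSupremum x) _ (proj₁ (⨆-isSupremum (↡ x) dir))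

    -- Every Scott open set around v contains all upper bounds of v, so only y
    -- needs to be approximated; HausdorffSeparated itself is too large to
    -- define an element of the powerset.
    Inseparable : Carrier → Pred Carrier ℓ
    Inseparable v y = ∀ {b} → b ∈ ↡ y → ¬ ¬ (∃[ z ] v ⊑ z × b ⊑ z)

    Inseparable-isScottClosed : ∀ v → IsScottClosed (Inseparable v)
    Inseparable-isScottClosed v = lower , closed
      where
      lower : ∀ {x y} → y ⊑ x → x ∈ Inseparable v → y ∈ Inseparable v
      lower y⊑x insep b∈↡y = insep (↡-mono y⊑x b∈↡y)

      closed : ∀ S (dir : IsDirected poset S) → S ⊆ Inseparable v → ⨆ S dir ∈ Inseparable v
      -- An approximant of the supremum already approximates some `s` in `S`, so the condition at
      -- `s` suffices.
      closed S dir S⊆ b∈↡⨆S with ≪-⨆ S dir (↡⇒≪ b∈↡⨆S)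
      ... | s , s∈S , b≪s = S⊆ s∈S (≪⇒↡ b≪s)

    ⊑⇒Inseparable : ∀ {v y} → v ⊑ y → y ∈ Inseparable v
    ⊑⇒Inseparable {y = y} v⊑y b∈↡y unbounded = unbounded (y , v⊑y , ↡-⊑ b∈↡y)

    -- Some `b ≪ y` lies in `V`, so an upper bound of `v` and `b` would lie in both `U` and `V`. The
    -- goal is a negation, so a bound under double negation is enough.
    Inseparable⇒¬HausdorffSeparated : ∀ {v y} → y ∈ Inseparable v → ¬ HausdorffSeparated v y
    Inseparable⇒¬HausdorffSeparated insep (U , V , U-open , V-open , v∈U , y∈V , U⊥V)
      with open⇒approximant V-open y∈V
    ... | b , b∈↡y , b∈V = insep b∈↡y λ (z , v⊑z , b⊑z) →
      U⊥V (proj₁ U-open v⊑z v∈U , proj₁ V-open b⊑z b∈V)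

    stronglyMaximal-Inseparable⇒≪ : ∀ {u v y} → u ≪ v →
      IsStronglyMaximal y → y ∈ Inseparable v → u ≪ y
    stronglyMaximal-Inseparable⇒≪ {u} {v} u≪v y-max insep with y-max u v u≪v
    ... | inj₁ u≪y = u≪y
    ... | inj₂ sep = ⊥-elim (Inseparable⇒¬HausdorffSeparated insep sep)

proposition6p17 : ∀ {ℓ n} (D : DCPO ℓ) → let open DCPO D in
    IsContinuous →
    (x : StronglyMaximal) (N : Pred StronglyMaximal n) →
    IsNeighbourhood x N →
    Σ (Pred StronglyMaximal ℓ) λ K →
    IsRelativelyClosed K × IsNeighbourhood x K × K ⊆ N
proposition6p17 D cont x N (A , (U , U-open , A⊆U , U⊆A) , x∈A , A⊆N)
  with open⇒approximant D cont U-open (A⊆U x∈A)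
... | u , u∈↡x , u∈U with ≪-interpolate D cont (↡⇒≪ D cont u∈↡x)
... | v , u≪v , v≪x =
  K ,
  (Inseparable D cont v , Inseparable-isScottClosed D cont v , id , id) ,
  -- The open core of `K` is the set of points way above `v`; it contains `x` because `v`
  -- interpolates between `u` and `x`.
  (proj₁ ⊢ ↟ D cont v ,
    (↟ D cont v , ↟-isScottOpen D cont v , id , id) ,
    ≪⇒↡ D cont v≪x ,
    λ v∈↡y → ⊑⇒Inseparable D cont (↡-⊑ D cont v∈↡y)) ,
  K⊆N
  where
  open DCPO D

  K : Pred StronglyMaximal _
  K = proj₁ ⊢ Inseparable D cont v

  K⊆N : K ⊆ N
  K⊆N {y , y-max} y∈K = A⊆N (U⊆A (proj₁ U-open (↡-⊑ D cont (≪⇒↡ D cont u≪y)) u∈U))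
    where
    u≪y : u ≪ y
    u≪y = stronglyMaximal-Inseparable⇒≪ D cont u≪v y-max y∈K
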